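{- Let $(P,\mathcal{L})$ be a linear system with $|\mathcal{L}| > \nu_2(P,\mathcal{L})$. Let $p,q\in P$ be two distinct points such that $\deg(p)=\Delta(P,\mathcal{L})$ and $\deg(q)=\max\{\deg(x): x\in P\setminus\{p\}\}$. If $$|\mathcal{L}| \le \deg(p)+\deg(q)+\nu_2(P,\mathcal{L})-3,$$ then $\tau(P,\mathcal{L}) \le \nu_2(P,\mathcal{L})-1$.
   Context: A linear system is a pair $(P,\mathcal{L})$ where $P$ is a finite set (of points) and $\mathcal{L}$ is a family of subsets of $P$ (lines) such that $|l\cap l'|\le 1$ for every pair of distinct $l,l'\in\mathcal{L}$. A transversal is a set $T\subseteq P$ with $T\cap l\neq\emptyset$ for every $l\in\mathcal{L}$; $\tau(P,\mathcal{L})$ is the minimum cardinality of a transversal. A 2-packing is a set $R\subseteq\mathcal{L}$ such that no three distinct lines of $R$ have a common point; $\nu_2(P,\mathcal{L})$ is the maximum cardinality of a 2-packing. For $x\in P$, $\mathcal{L}_x$ is the set of lines containing $x$, $\deg(x)=|\mathcal{L}_x|$, and $\Delta(P,\mathcal{L})=\max_{x\in P}\deg(x)$. -}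

module Defs where

open import Data.Fin using (Fin)
import Data.Fin.Properties as Fin
open import Data.Fin.Subset using (Subset; _∈_; _∩_; ∣_∣; Nonempty; ⊤; ⊥)
open import Data.Fin.Subset.Properties
  using (_∈?_; nonempty?; anySubset?; ∣p∣≤n; ∉⊥; ∈⊤; x∈p∩q⁺)
open import Data.Nat using (ℕ; zero; suc; _≤_; _<_; _≟_; z≤n; s≤s⁻¹)
open import Data.Nat.Properties
  using (anyUpTo?; ≮⇒≥; ≤∧≢⇒<)
open import Data.Nat.Induction using (<-rec)
open import Data.Product using (∃; ∃-syntax; _×_; _,_)
open import Data.Vec using (tabulate; lookup)
open import Function.Definitions using (Injective)
open import Relation.Binary.PropositionalEquality using (_≡_; _≢_; refl)
open import Relation.Nullary using (¬_; yes; no; contradiction)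
open import Relation.Nullary.Decidable using (¬?; _×-dec_; _→-dec_)
open import Relation.Unary using (Pred; Decidable)
open import Level using (0ℓ)

IsMinimum : Pred ℕ 0ℓ → ℕ → Set
IsMinimum S a = S a × (∀ b → S b → a ≤ b)

IsMaximum : Pred ℕ 0ℓ → ℕ → Set
IsMaximum S a = S a × (∀ b → S b → b ≤ a)

-- The point set P is Fin n.  The set 𝓛 is enumerated without repetition by
-- Fin m, so that |𝓛| = m, a set of lines is a Subset m, and lines are distinct
-- exactly when their indices are.  Empty lines are not excluded.
record LinearSystem (n m : ℕ) : Set where
  field
    line           : Fin m → Subset n
    line-injective : Injective _≡_ _≡_ line
    linear         : ∀ i j → i ≢ j → ∣ line i ∩ line j ∣ ≤ 1

module _ {n m : ℕ} (L : LinearSystem n m) where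
  open LinearSystem L

  IsTransversal : Subset n → Set
  IsTransversal T = ∀ i → Nonempty (T ∩ line i)

  -- IsTransversalNumber t says τ(P,𝓛) = t.  Such a t exists as soon as there is
  -- a transversal, i.e. when no line is empty (transversalNumber-exists).
  IsTransversalNumber : ℕ → Set
  IsTransversalNumber = IsMinimum λ k → ∃[ T ] IsTransversal T × ∣ T ∣ ≡ k

  IsTwoPacking : Subset m → Set
  IsTwoPacking R = ∀ i j k → i ∈ R → j ∈ R → k ∈ R →
    i ≢ j → i ≢ k → j ≢ k →
    ¬ (∃[ x ] x ∈ line i × x ∈ line j × x ∈ line k)

  -- IsTwoPackingNumber k says ν₂(P,𝓛) = k; it is always defined
  -- (twoPackingNumber-exists).
  IsTwoPackingNumber : ℕ → Set
  IsTwoPackingNumber = IsMaximum λ k → ∃[ R ] IsTwoPacking R × ∣ R ∣ ≡ k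

  linesThrough : Fin n → Subset m
  linesThrough x = tabulate λ i → lookup (line i) x

  deg : Fin n → ℕ
  deg x = ∣ linesThrough x ∣

  -- IsMaximumDegree d says Δ(P,𝓛) = d.
  IsMaximumDegree : ℕ → Set
  IsMaximumDegree = IsMaximum λ d → ∃[ x ] deg x ≡ d

minimum-exists : ∀ {S} → Decidable S → ∃ S → ∃ (IsMinimum S)
minimum-exists {S} S? (a , Sa) = <-rec _ step a Sa
  where
  step : ∀ a → (∀ {b} → b < a → S b → ∃ (IsMinimum S)) → S a → ∃ (IsMinimum S)
  step a rec Sa with anyUpTo? S? a
  ... | yes (b , b<a , Sb) = rec b<a Sb
  ... | no  none           = a , Sa , λ b Sb → ≮⇒≥ λ b<a → none (b , b<a , Sb)

maximum-exists : ∀ {S} → Decidable S → ∃ S → ∀ u → (∀ b → S b → b ≤ u) →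
                 ∃ (IsMaximum S)
maximum-exists S? (a , Sa) u bound with S? u
... | yes Su = u , Su , bound
maximum-exists S? (a , Sa) zero bound | no ¬Su with bound a Sa
... | z≤n = contradiction Sa ¬Su
maximum-exists S? e (suc u) bound | no ¬Su = maximum-exists S? e u λ b Sb →
  s≤s⁻¹ (≤∧≢⇒< (bound b Sb) λ { refl → ¬Su Sb })

module _ {n m : ℕ} (L : LinearSystem n m) where
  open LinearSystem L

  transversalNumber-exists : (∀ i → Nonempty (line i)) →
                             ∃ (IsTransversalNumber L)
  transversalNumber-exists nonempty = minimum-exists
    (λ k → anySubset? λ T →
      Fin.all? (λ i → nonempty? (T ∩ line i)) ×-dec (∣ T ∣ ≟ k))
    (_ , ⊤ , (λ i → let x , x∈i = nonempty i in x , x∈p∩q⁺ (∈⊤ , x∈i)) , refl)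

  twoPackingNumber-exists : ∃ (IsTwoPackingNumber L)
  twoPackingNumber-exists = maximum-exists
    (λ k → anySubset? λ R →
      (Fin.all? λ i → Fin.all? λ j → Fin.all? λ k →
        (i ∈? R) →-dec (j ∈? R) →-dec (k ∈? R) →-dec
        ¬? (i Fin.≟ j) →-dec ¬? (i Fin.≟ k) →-dec ¬? (j Fin.≟ k) →-dec
        ¬? (Fin.any? λ x →
              (x ∈? line i) ×-dec (x ∈? line j) ×-dec (x ∈? line k)))
      ×-dec (∣ R ∣ ≟ k))
    (_ , ⊥ , (λ _ _ _ i∈⊥ → contradiction i∈⊥ ∉⊥) , refl)
    m (λ { _ (R , _ , refl) → ∣p∣≤n R })

{-# OPTIONS --safe #-}
-- Let U be the set of lines avoiding p and q.  By inclusion–exclusion the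
-- hypothesis reads |U| + 3 ≤ ν₂ + |𝓛_p ∩ 𝓛_q|, and |𝓛_p ∩ 𝓛_q| ≤ 1.  Taking p, q and
-- a point on each line of U gives τ ≤ |U| + 2, which is enough unless some line l
-- contains both p and q.  In that case either |U| + 3 ≤ ν₂, and the same
-- transversal works, or τ ≤ |U| + 1:
--   * two lines of U with a common point share their representative;
--   * if U is pairwise disjoint, a contains p but not q, b contains q but not p,
--     and no line of U passes through a ∩ b, then U ∪ {l, a, b} is a 2-packing;
--   * otherwise fix a (if there is none, q and U suffice).  Every b meets a on
--     some line of U, so representing each line of U by its point on a covers
--     all b, and p covers the rest.
module Submission where

open import Defs
open import Data.Fin using (Fin; zero; suc)
import Data.Fin.Properties as Fin
open import Data.Fin.Subset
  using (Subset; inside; outside; _∈_; _∉_; _∪_; _∩_; _-_; ∁; ⁅_⁆; ∣_∣; Nonempty; ⊥)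
open import Data.Fin.Subset.Properties
open import Data.Nat using (ℕ; suc; _+_; _≤_; _<_; z≤n; s≤s; s≤s⁻¹)
open import Data.Nat.Properties
  using (≤-trans; ≤-reflexive; <⇒≱; +-comm; +-suc; +-assoc;
         +-mono-≤; +-monoˡ-≤; +-monoʳ-≤; +-cancelˡ-≤; m≤m+n; m+[n∸m]≡n;
         module ≤-Reasoning)
open import Data.Product using (∃-syntax; _×_; _,_; proj₁; proj₂)
open import Data.Sum using (_⊎_; inj₁; inj₂; [_,_]′)
open import Data.Vec using ([]; _∷_; here; there)
open import Data.Vec.Properties using (lookup∘tabulate; []=⇒lookup; lookup⇒[]=)
open import Function using (_∘_)
open import Relation.Binary.PropositionalEquality
  using (_≡_; _≢_; refl; sym; trans; cong; cong₂; subst; ≢-sym; module ≡-Reasoning)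
open import Relation.Nullary using (¬_; Dec; yes; no; contradiction)
open import Relation.Nullary.Decidable using (¬?; _×-dec_; decidable-stable)

-- Cardinalities of finite subsets

∣p∪q∣+∣p∩q∣≡∣p∣+∣q∣ : ∀ {n} (p q : Subset n) →
  ∣ p ∪ q ∣ + ∣ p ∩ q ∣ ≡ ∣ p ∣ + ∣ q ∣
∣p∪q∣+∣p∩q∣≡∣p∣+∣q∣ []            []            = refl
∣p∪q∣+∣p∩q∣≡∣p∣+∣q∣ (outside ∷ p) (outside ∷ q) = ∣p∪q∣+∣p∩q∣≡∣p∣+∣q∣ p q
∣p∪q∣+∣p∩q∣≡∣p∣+∣q∣ (inside  ∷ p) (outside ∷ q) =
  cong suc (∣p∪q∣+∣p∩q∣≡∣p∣+∣q∣ p q)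
∣p∪q∣+∣p∩q∣≡∣p∣+∣q∣ (outside ∷ p) (inside  ∷ q) =
  trans (cong suc (∣p∪q∣+∣p∩q∣≡∣p∣+∣q∣ p q)) (sym (+-suc ∣ p ∣ ∣ q ∣))
∣p∪q∣+∣p∩q∣≡∣p∣+∣q∣ (inside  ∷ p) (inside  ∷ q) = cong suc
  (trans (+-suc ∣ p ∪ q ∣ ∣ p ∩ q ∣)
    (trans (cong suc (∣p∪q∣+∣p∩q∣≡∣p∣+∣q∣ p q)) (sym (+-suc ∣ p ∣ ∣ q ∣))))

∣p∪q∣≤∣p∣+∣q∣ : ∀ {n} (p q : Subset n) → ∣ p ∪ q ∣ ≤ ∣ p ∣ + ∣ q ∣
∣p∪q∣≤∣p∣+∣q∣ p q = ≤-trans (m≤m+n _ _) (≤-reflexive (∣p∪q∣+∣p∩q∣≡∣p∣+∣q∣ p q))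

∣p∣+∣∁p∣≡n : ∀ {n} (p : Subset n) → ∣ p ∣ + ∣ ∁ p ∣ ≡ n
∣p∣+∣∁p∣≡n p = trans (cong (∣ p ∣ +_) (∣∁p∣≡n∸∣p∣ p)) (m+[n∸m]≡n (∣p∣≤n p))

∣p∣≤1⇒unique : ∀ {n} {p : Subset n} {x y} → ∣ p ∣ ≤ 1 → x ∈ p → y ∈ p → x ≡ y
∣p∣≤1⇒unique {x = x} {y} ∣p∣≤1 x∈p y∈p = decidable-stable (x Fin.≟ y) λ x≢y →
  -- `p - x` still contains `y`, hence is nonempty, and restoring `x` makes at least two elements.
  <⇒≱ (≤-trans (s≤s (≤-trans (s≤s z≤n) (x∈p⇒∣p-x∣<∣p∣ (x∈p∧x≢y⇒x∈p-y y∈p (≢-sym x≢y)))))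
                (x∈p⇒∣p-x∣<∣p∣ x∈p))
    ∣p∣≤1

unique⇒∣p∣≤1 : ∀ {n} {p : Subset n} {x} → (∀ {y} → y ∈ p → y ≡ x) → ∣ p ∣ ≤ 1
unique⇒∣p∣≤1 {p = p} {x} unique = ≤-trans
  (p⊆q⇒∣p∣≤∣q∣ λ y∈p → subst (_∈ ⁅ x ⁆) (sym (unique y∈p)) (x∈⁅x⁆ x))
  (≤-reflexive (∣⁅x⁆∣≡1 x))

x∉p⇒∣p∣<∣⁅x⁆∪p∣ : ∀ {n} {p : Subset n} {x} → x ∉ p → ∣ p ∣ < ∣ ⁅ x ⁆ ∪ p ∣
x∉p⇒∣p∣<∣⁅x⁆∪p∣ {p = p} {x} x∉p = p⊂q⇒∣p∣<∣q∣
  (q⊆p∪q ⁅ x ⁆ p , x , p⊆p∪q p (x∈⁅x⁆ x) , x∉p)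

y∈⁅x⁆∪p⁻ : ∀ {n} {p : Subset n} {x y} → y ∈ ⁅ x ⁆ ∪ p → y ≡ x ⊎ y ∈ p
y∈⁅x⁆∪p⁻ {p = p} {x} y∈ with x∈p∪q⁻ ⁅ x ⁆ p y∈
... | inj₁ y∈⁅x⁆ = inj₁ (x∈⁅y⁆⇒x≡y x y∈⁅x⁆)
... | inj₂ y∈p   = inj₂ y∈p

-- Turns a choice of representatives into a point set. Repeated values can make it smaller than `R`,
-- so only an upper bound is kept.
image : ∀ {n m} (R : Subset m) (f : Fin m → Fin n) →
        ∃[ T ] ∣ T ∣ ≤ ∣ R ∣ × (∀ {i} → i ∈ R → f i ∈ T)
image {n} []        f = ⊥ , ≤-reflexive (∣⊥∣≡0 n) , λ ()
image (outside ∷ R) f with image R (f ∘ suc)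
... | T , T≤R , f∈T = T , T≤R , λ { (there i∈R) → f∈T i∈R }
image (inside ∷ R) f with image R (f ∘ suc)
... | T , T≤R , f∈T =
  ⁅ f zero ⁆ ∪ T ,
  ≤-trans (∣p∪q∣≤∣p∣+∣q∣ ⁅ f zero ⁆ T) (+-mono-≤ (≤-reflexive (∣⁅x⁆∣≡1 (f zero))) T≤R) ,
  λ { here        → p⊆p∪q T (x∈⁅x⁆ (f zero))
    ; (there i∈R) → q⊆p∪q ⁅ f zero ⁆ T (f∈T i∈R) }

-- Supplies the side condition of `twoPacking-insert` when lines are added one at a time: there
-- `C i j` is non-concurrence of `i` and `j` with a fixed line.
pairwise-insert : ∀ {m} {C : Fin m → Fin m → Set} {R : Subset m} {x} →
  (∀ {i j} → C i j → C j i) →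
  (∀ {i j} → i ∈ R → j ∈ R → i ≢ j → C i j) →
  (∀ {j} → j ∈ R → C x j) →
  ∀ {i j} → i ∈ ⁅ x ⁆ ∪ R → j ∈ ⁅ x ⁆ ∪ R → i ≢ j → C i j
pairwise-insert C-sym C-R C-x i∈ j∈ i≢j with y∈⁅x⁆∪p⁻ i∈ | y∈⁅x⁆∪p⁻ j∈
... | inj₁ refl | inj₁ refl = contradiction refl i≢j
... | inj₁ refl | inj₂ j∈R  = C-x j∈R
... | inj₂ i∈R  | inj₁ refl = C-sym (C-x i∈R)
... | inj₂ i∈R  | inj₂ j∈R  = C-R i∈R j∈R i≢j

-- Concurrent lines and 2-packings

module _ {n m : ℕ} (L : LinearSystem n m) where
  open LinearSystem L

  Concurrent : Fin m → Fin m → Fin m → Set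
  Concurrent i j k = ∃[ x ] x ∈ line i × x ∈ line j × x ∈ line k

  concurrent? : ∀ i j k → Dec (Concurrent i j k)
  concurrent? i j k = Fin.any? λ x →
    (x ∈? line i) ×-dec (x ∈? line j) ×-dec (x ∈? line k)

  ¬concurrent-swap : ∀ {i j k} → ¬ Concurrent i j k → ¬ Concurrent i k j
  ¬concurrent-swap ¬ijk (x , x∈i , x∈k , x∈j) = ¬ijk (x , x∈i , x∈j , x∈k)

  ∈linesThrough⁺ : ∀ {i x} → x ∈ line i → i ∈ linesThrough L x
  ∈linesThrough⁺ {i} {x} x∈i =
    lookup⇒[]= i _ (trans (lookup∘tabulate _ i) ([]=⇒lookup x∈i))

  ∈linesThrough⁻ : ∀ {i x} → i ∈ linesThrough L x → x ∈ line i
  ∈linesThrough⁻ {i} {x} i∈ =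
    lookup⇒[]= x _ (trans (sym (lookup∘tabulate _ i)) ([]=⇒lookup i∈))

  -- Linearity enters the proof only through this lemma.
  meet-unique : ∀ {i j x y} → i ≢ j → x ∈ line i → x ∈ line j →
                y ∈ line i → y ∈ line j → x ≡ y
  meet-unique i≢j x∈i x∈j y∈i y∈j =
    ∣p∣≤1⇒unique (linear _ _ i≢j) (x∈p∩q⁺ (x∈i , x∈j)) (x∈p∩q⁺ (y∈i , y∈j))

  -- A triple of distinct lines uses the new line at most once, so only pairs from `R` have to be
  -- checked against it.
  twoPacking-insert : ∀ {R x} → IsTwoPacking L R →
    (∀ {i j} → i ∈ R → j ∈ R → i ≢ j → ¬ Concurrent x i j) →
    IsTwoPacking L (⁅ x ⁆ ∪ R)
  twoPacking-insert packing free i j k i∈ j∈ k∈ i≢j i≢k j≢k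
    (y , y∈i , y∈j , y∈k) with y∈⁅x⁆∪p⁻ i∈ | y∈⁅x⁆∪p⁻ j∈ | y∈⁅x⁆∪p⁻ k∈
  ... | inj₁ refl | inj₁ refl | _         = i≢j refl
  ... | inj₁ refl | inj₂ _    | inj₁ refl = i≢k refl
  ... | inj₂ _    | inj₁ refl | inj₁ refl = j≢k refl
  ... | inj₁ refl | inj₂ j∈R  | inj₂ k∈R  = free j∈R k∈R j≢k (y , y∈i , y∈j , y∈k)
  ... | inj₂ i∈R  | inj₁ refl | inj₂ k∈R  = free i∈R k∈R i≢k (y , y∈j , y∈i , y∈k)
  ... | inj₂ i∈R  | inj₂ j∈R  | inj₁ refl = free i∈R j∈R i≢j (y , y∈k , y∈i , y∈j)
  ... | inj₂ i∈R  | inj₂ j∈R  | inj₂ k∈R  =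
    packing i j k i∈R j∈R k∈R i≢j i≢k j≢k (y , y∈i , y∈j , y∈k)

  -- Transversals built from representatives

  module _ {τ : ℕ} (isτ : IsTransversalNumber L τ) where

    -- `W` together with the points `f j` for `j` in `R` is a transversal. A line may be hit by the
    -- representative of another line, which is how later bounds save a point.
    transversalNumber≤ : (W : Subset n) (R : Subset m) (f : Fin m → Fin n) →
      (∀ i → (∃[ x ] x ∈ W × x ∈ line i) ⊎ (∃[ j ] j ∈ R × f j ∈ line i)) →
      τ ≤ ∣ W ∣ + ∣ R ∣
    transversalNumber≤ W R f covers with image R f
    ... | T , T≤R , f∈T = begin
      τ             ≤⟨ proj₂ isτ _ (W ∪ T , hits , refl) ⟩
      ∣ W ∪ T ∣     ≤⟨ ∣p∪q∣≤∣p∣+∣q∣ W T ⟩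
      ∣ W ∣ + ∣ T ∣ ≤⟨ +-monoʳ-≤ ∣ W ∣ T≤R ⟩
      ∣ W ∣ + ∣ R ∣ ∎
      where
      open ≤-Reasoning
      hits : IsTransversal L (W ∪ T)
      hits i with covers i
      ... | inj₁ (x , x∈W , x∈i)  = x , x∈p∩q⁺ (p⊆p∪q T x∈W , x∈i)
      ... | inj₂ (j , j∈R , fj∈i) = f j , x∈p∩q⁺ (q⊆p∪q W T (f∈T j∈R) , fj∈i)

    -- Since `τ` is attained, some transversal exists, and it meets every line.
    nonempty-line : ∀ i → Nonempty (line i)
    nonempty-line i with proj₁ isτ
    ... | T , transversal , _ with transversal i
    ...   | x , x∈T∩i = x , proj₂ (x∈p∩q⁻ T (line i) x∈T∩i)

    -- Steers representatives: with `S` a single point, lines through it share that point; with `S`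
    -- a line, representatives fall on it whenever possible.
    pointPreferring : (S : Subset n) (i : Fin m) →
      ∃[ x ] x ∈ line i × (Nonempty (S ∩ line i) → x ∈ S)
    pointPreferring S i with nonempty? (S ∩ line i)
    ... | yes (x , x∈S∩i) = let x∈S , x∈i = x∈p∩q⁻ S (line i) x∈S∩i in
                            x , x∈i , λ _ → x∈S
    ... | no  empty       = let x , x∈i = nonempty-line i in
                            x , x∈i , λ nonempty → contradiction nonempty empty

  -- Lines avoiding both points, and the degree hypothesis as a count

  module _ (p q : Fin n) where

    avoiding : Subset m
    avoiding = ∁ (linesThrough L p ∪ linesThrough L q)

    ∈avoiding : ∀ {i} → p ∉ line i → q ∉ line i → i ∈ avoiding
    ∈avoiding p∉i q∉i = x∉p⇒x∈∁p λ i∈ →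
      [ p∉i ∘ ∈linesThrough⁻ , q∉i ∘ ∈linesThrough⁻ ]′ (x∈p∪q⁻ _ _ i∈)

    avoiding⇒p∉ : ∀ {i} → i ∈ avoiding → p ∉ line i
    avoiding⇒p∉ i∈U p∈i = x∈∁p⇒x∉p i∈U (p⊆p∪q _ (∈linesThrough⁺ p∈i))

    avoiding⇒q∉ : ∀ {i} → i ∈ avoiding → q ∉ line i
    avoiding⇒q∉ i∈U q∈i = x∈∁p⇒x∉p i∈U (q⊆p∪q _ _ (∈linesThrough⁺ q∈i))

    -- Two lines of `avoiding` are disjoint. The line `l` meets `a` only at `p` and `b` only at `q`,
    -- and a third line misses that point. The last kind of triple, `a`, `b` and a line of
    -- `avoiding`, is excluded by assumption.
    twoPacking-l,a,b : ∀ {l a b} →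
      p ∈ line l → q ∈ line l →
      p ∈ line a → q ∉ line a →
      q ∈ line b → p ∉ line b →
      (∀ {i j x} → i ∈ avoiding → j ∈ avoiding → i ≢ j →
        x ∈ line i → x ∉ line j) →
      (∀ {k} → k ∈ avoiding → ¬ Concurrent a b k) →
      IsTwoPacking L (⁅ l ⁆ ∪ ⁅ a ⁆ ∪ ⁅ b ⁆ ∪ avoiding)
    twoPacking-l,a,b {l} {a} {b} p∈l q∈l p∈a q∉a q∈b p∉b disjoint ¬abk =
      twoPacking-insert
        (twoPacking-insert
          (twoPacking-insert packing disjoint′)
          (pairwise-insert ¬concurrent-swap disjoint′ ¬abk))
        (pairwise-insert ¬concurrent-swap
          (pairwise-insert ¬concurrent-swap disjoint′ λ k∈U → ¬lbk (avoiding⇒q∉ k∈U))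
          λ k∈ → ¬lak (p∉b∪U k∈))
      where
      disjoint′ : ∀ {x i j} → i ∈ avoiding → j ∈ avoiding → i ≢ j → ¬ Concurrent x i j
      disjoint′ i∈U j∈U i≢j (_ , _ , y∈i , y∈j) = disjoint i∈U j∈U i≢j y∈i y∈j
      packing : IsTwoPacking L avoiding
      packing i j k i∈U j∈U k∈U i≢j i≢k j≢k = disjoint′ j∈U k∈U j≢k
      ¬lak : ∀ {k} → p ∉ line k → ¬ Concurrent l a k
      ¬lak {k} p∉k (y , y∈l , y∈a , y∈k) = p∉k (subst (_∈ line k)
        (meet-unique (λ { refl → q∉a q∈l }) y∈l y∈a p∈l p∈a) y∈k)
      ¬lbk : ∀ {k} → q ∉ line k → ¬ Concurrent l b k
      ¬lbk {k} q∉k (y , y∈l , y∈b , y∈k) = q∉k (subst (_∈ line k)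
        (meet-unique (λ { refl → p∉b p∈l }) y∈l y∈b q∈l q∈b) y∈k)
      p∉b∪U : ∀ {k} → k ∈ ⁅ b ⁆ ∪ avoiding → p ∉ line k
      p∉b∪U k∈ with y∈⁅x⁆∪p⁻ k∈
      ... | inj₁ refl = p∉b
      ... | inj₂ k∈U  = avoiding⇒p∉ k∈U

    -- Lines through `p` or `q` lie outside `avoiding`, and `l`, `a`, `b` are told apart by which of
    -- the two points they contain.
    3+∣avoiding∣≤ : ∀ {l a b} →
      p ∈ line l → q ∈ line l →
      p ∈ line a → q ∉ line a →
      q ∈ line b → p ∉ line b →
      3 + ∣ avoiding ∣ ≤ ∣ ⁅ l ⁆ ∪ ⁅ a ⁆ ∪ ⁅ b ⁆ ∪ avoiding ∣
    3+∣avoiding∣≤ {l} {a} {b} p∈l q∈l p∈a q∉a q∈b p∉b =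
      ≤-trans (s≤s (≤-trans (s≤s (x∉p⇒∣p∣<∣⁅x⁆∪p∣ b∉)) (x∉p⇒∣p∣<∣⁅x⁆∪p∣ a∉)))
        (x∉p⇒∣p∣<∣⁅x⁆∪p∣ l∉)
      where
      b∉ : b ∉ avoiding
      b∉ b∈U = avoiding⇒q∉ b∈U q∈b
      a∉ : a ∉ ⁅ b ⁆ ∪ avoiding
      a∉ a∈ with y∈⁅x⁆∪p⁻ a∈
      ... | inj₁ refl = p∉b p∈a
      ... | inj₂ a∈U  = avoiding⇒p∉ a∈U p∈a
      l∉ : l ∉ ⁅ a ⁆ ∪ ⁅ b ⁆ ∪ avoiding
      l∉ l∈ with y∈⁅x⁆∪p⁻ l∈
      ... | inj₁ refl = q∉a q∈l
      ... | inj₂ l∈′ with y∈⁅x⁆∪p⁻ l∈′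
      ...   | inj₁ refl = p∉b p∈l
      ...   | inj₂ l∈U  = avoiding⇒p∉ l∈U p∈l

    -- Inclusion-exclusion for the lines through `p` and through `q`, combined with the complement
    -- of their union.
    degree-sum : deg L p + deg L q + ∣ avoiding ∣ ≡
                 m + ∣ linesThrough L p ∩ linesThrough L q ∣
    degree-sum = begin
      deg L p + deg L q + u ≡⟨ cong (_+ u) (∣p∪q∣+∣p∩q∣≡∣p∣+∣q∣ Lp Lq) ⟨
      ∣ Lp ∪ Lq ∣ + c + u   ≡⟨ +-assoc ∣ Lp ∪ Lq ∣ c u ⟩
      ∣ Lp ∪ Lq ∣ + (c + u) ≡⟨ cong (∣ Lp ∪ Lq ∣ +_) (+-comm c u) ⟩
      ∣ Lp ∪ Lq ∣ + (u + c) ≡⟨ +-assoc ∣ Lp ∪ Lq ∣ u c ⟨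
      ∣ Lp ∪ Lq ∣ + u + c   ≡⟨ cong (_+ c) (∣p∣+∣∁p∣≡n (Lp ∪ Lq)) ⟩
      m + c                 ∎
      where
      open ≡-Reasoning
      Lp = linesThrough L p
      Lq = linesThrough L q
      u = ∣ avoiding ∣
      c = ∣ Lp ∩ Lq ∣

    -- After adding `∣ avoiding ∣` to both sides of the bound, `degree-sum` replaces the degrees and
    -- `m` cancels.
    3+∣avoiding∣≤∣Lp∩Lq∣+ν₂ : ∀ ν₂ → m + 3 ≤ deg L p + deg L q + ν₂ →
      3 + ∣ avoiding ∣ ≤ ∣ linesThrough L p ∩ linesThrough L q ∣ + ν₂
    3+∣avoiding∣≤∣Lp∩Lq∣+ν₂ ν₂ bound = +-cancelˡ-≤ m _ _ (begin
      m + (3 + u)                   ≡⟨ +-assoc m 3 u ⟨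
      m + 3 + u                     ≤⟨ +-monoˡ-≤ u bound ⟩
      deg L p + deg L q + ν₂ + u    ≡⟨ +-assoc (deg L p + deg L q) ν₂ u ⟩
      deg L p + deg L q + (ν₂ + u)  ≡⟨ cong (deg L p + deg L q +_) (+-comm ν₂ u) ⟩
      deg L p + deg L q + (u + ν₂)  ≡⟨ +-assoc (deg L p + deg L q) u ν₂ ⟨
      deg L p + deg L q + u + ν₂    ≡⟨ cong (_+ ν₂) degree-sum ⟩
      m + c + ν₂                    ≡⟨ +-assoc m c ν₂ ⟩
      m + (c + ν₂)                  ∎)
      where
      open ≤-Reasoning
      u = ∣ avoiding ∣
      c = ∣ linesThrough L p ∩ linesThrough L q ∣

    -- Upper bounds on τ in terms of the avoiding lines

    module _ {τ : ℕ} (isτ : IsTransversalNumber L τ) where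

      ∣⁅p⁆∪⁅q⁆∣≤2 : ∣ ⁅ p ⁆ ∪ ⁅ q ⁆ ∣ ≤ 2
      ∣⁅p⁆∪⁅q⁆∣≤2 = ≤-trans (∣p∪q∣≤∣p∣+∣q∣ ⁅ p ⁆ ⁅ q ⁆)
        (≤-reflexive (cong₂ _+_ (∣⁅x⁆∣≡1 p) (∣⁅x⁆∣≡1 q)))

      -- The points `p` and `q` account for the 2. `R` is left free so that it can be smaller than
      -- `avoiding`.
      transversalNumber≤2+∣R∣ : (R : Subset m) (f : Fin m → Fin n) →
        (∀ {i} → i ∈ avoiding → ∃[ j ] j ∈ R × f j ∈ line i) → τ ≤ 2 + ∣ R ∣
      transversalNumber≤2+∣R∣ R f covers = ≤-trans
        (transversalNumber≤ isτ (⁅ p ⁆ ∪ ⁅ q ⁆) R f hit) (+-monoˡ-≤ ∣ R ∣ ∣⁅p⁆∪⁅q⁆∣≤2)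
        where
        hit : ∀ i → (∃[ x ] x ∈ ⁅ p ⁆ ∪ ⁅ q ⁆ × x ∈ line i) ⊎
                    (∃[ j ] j ∈ R × f j ∈ line i)
        hit i with p ∈? line i | q ∈? line i
        ... | yes p∈i | _       = inj₁ (p , p⊆p∪q _ (x∈⁅x⁆ p) , p∈i)
        ... | no  _   | yes q∈i = inj₁ (q , q⊆p∪q ⁅ p ⁆ _ (x∈⁅x⁆ q) , q∈i)
        ... | no  p∉i | no  q∉i = inj₂ (covers (∈avoiding p∉i q∉i))

      transversalNumber≤2+∣avoiding∣ : τ ≤ 2 + ∣ avoiding ∣
      transversalNumber≤2+∣avoiding∣ =
        transversalNumber≤2+∣R∣ avoiding (proj₁ ∘ nonempty-line isτ)
          λ {i} i∈U → i , i∈U , proj₂ (nonempty-line isτ i)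

      -- Representing `i` by `x` also hits `j`, so `j` is dropped from the index set and one point
      -- is saved.
      meeting⇒≤ : ∀ {i j x} → i ∈ avoiding → j ∈ avoiding → i ≢ j →
        x ∈ line i → x ∈ line j → τ ≤ 1 + ∣ avoiding ∣
      meeting⇒≤ {i} {j} {x} i∈U j∈U i≢j x∈i x∈j = ≤-trans
        (transversalNumber≤2+∣R∣ (avoiding - j) f covers) (s≤s (x∈p⇒∣p-x∣<∣p∣ j∈U))
        where
        f : Fin m → Fin n
        f k = proj₁ (pointPreferring isτ ⁅ x ⁆ k)
        covers : ∀ {k} → k ∈ avoiding → ∃[ h ] h ∈ avoiding - j × f h ∈ line k
        covers {k} k∈U with k Fin.≟ j
        ... | no  k≢j  = k , x∈p∧x≢y⇒x∈p-y k∈U k≢j , proj₁ (proj₂ (pointPreferring isτ ⁅ x ⁆ k))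
        ... | yes refl = i , x∈p∧x≢y⇒x∈p-y i∈U i≢j , subst (_∈ line j) (sym fi≡x) x∈j
          where
          fi≡x : f i ≡ x
          fi≡x = x∈⁅y⁆⇒x≡y x
            (proj₂ (proj₂ (pointPreferring isτ ⁅ x ⁆ i)) (x , x∈p∩q⁺ (x∈⁅x⁆ x , x∈i)))

      transversalNumber≤1+∣avoiding∣ : (x : Fin n) (f : Fin m → Fin n) →
        (∀ i → x ∉ line i → ∃[ j ] j ∈ avoiding × f j ∈ line i) →
        τ ≤ 1 + ∣ avoiding ∣
      transversalNumber≤1+∣avoiding∣ x f covers = ≤-trans
        (transversalNumber≤ isτ ⁅ x ⁆ avoiding f hit)
        (+-monoˡ-≤ ∣ avoiding ∣ (≤-reflexive (∣⁅x⁆∣≡1 x)))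
        where
        hit : ∀ i → (∃[ y ] y ∈ ⁅ x ⁆ × y ∈ line i) ⊎
                    (∃[ j ] j ∈ avoiding × f j ∈ line i)
        hit i with x ∈? line i
        ... | yes x∈i = inj₁ (x , x∈⁅x⁆ x , x∈i)
        ... | no  x∉i = inj₂ (covers i x∉i)

      -- A line missing `q` then misses `p` too, so it lies in `avoiding` and is hit by its own
      -- representative.
      p-lines⊆q-lines⇒≤ : (∀ {a} → p ∈ line a → q ∈ line a) → τ ≤ 1 + ∣ avoiding ∣
      p-lines⊆q-lines⇒≤ p∈⇒q∈ =
        transversalNumber≤1+∣avoiding∣ q (proj₁ ∘ nonempty-line isτ) λ i q∉i →
          i , ∈avoiding (q∉i ∘ p∈⇒q∈) q∉i , proj₂ (nonempty-line isτ i)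

      all-concurrent⇒≤ : ∀ {a} → p ∈ line a →
        (∀ {b} → q ∈ line b → p ∉ line b →
          ∃[ k ] k ∈ avoiding × Concurrent a b k) →
        τ ≤ 1 + ∣ avoiding ∣
      all-concurrent⇒≤ {a} p∈a concur = transversalNumber≤1+∣avoiding∣ p f covers
        where
        f : Fin m → Fin n
        f k = proj₁ (pointPreferring isτ (line a) k)
        f∈line : ∀ k → f k ∈ line k
        f∈line k = proj₁ (proj₂ (pointPreferring isτ (line a) k))
        covers : ∀ i → p ∉ line i → ∃[ k ] k ∈ avoiding × f k ∈ line i
        covers i p∉i with q ∈? line i
        ... | no  q∉i = i , ∈avoiding p∉i q∉i , f∈line i
        ... | yes q∈i with concur q∈i p∉i
        ...   | k , k∈U , y , y∈a , y∈i , y∈k =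
          k , k∈U , subst (_∈ line i) (sym fk≡y) y∈i
          where
          fk≡y : f k ≡ y
          -- `a` contains `p` and `k` does not, so they are distinct and share only one point, the
          -- one where `i` crosses them.
          fk≡y = meet-unique (λ { refl → avoiding⇒p∉ k∈U p∈a })
            (proj₂ (proj₂ (pointPreferring isτ (line a) k)) (y , x∈p∩q⁺ (y∈a , y∈k)))
            (f∈line k) y∈a y∈k

      twoPacking⊎small : ∀ {l} → p ∈ line l → q ∈ line l →
        (∃[ R ] IsTwoPacking L R × 3 + ∣ avoiding ∣ ≤ ∣ R ∣) ⊎ τ ≤ 1 + ∣ avoiding ∣
      twoPacking⊎small {l} p∈l q∈l
        with Fin.any? (λ i → Fin.any? λ j → Fin.any? λ x →
               (i ∈? avoiding) ×-dec (j ∈? avoiding) ×-dec ¬? (i Fin.≟ j) ×-dec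
               (x ∈? line i) ×-dec (x ∈? line j))
      ... | yes (_ , _ , _ , i∈U , j∈U , i≢j , x∈i , x∈j) =
        inj₂ (meeting⇒≤ i∈U j∈U i≢j x∈i x∈j)
      ... | no ¬meeting with Fin.any? (λ a → (p ∈? line a) ×-dec ¬? (q ∈? line a))
      ...   | no ¬a = inj₂ (p-lines⊆q-lines⇒≤ λ {a} p∈a →
        decidable-stable (q ∈? line a) λ q∉a → ¬a (a , p∈a , q∉a))
      ...   | yes (a , p∈a , q∉a)
        with Fin.any? (λ b → (q ∈? line b) ×-dec ¬? (p ∈? line b) ×-dec
               ¬? (Fin.any? λ k → (k ∈? avoiding) ×-dec concurrent? a b k))
      ...     | no ¬b = inj₂ (all-concurrent⇒≤ p∈a λ {b} q∈b p∉b →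
        -- The failed search for `b` gives only a double negation; decidability of concurrence turns
        -- it into a witness `k` for each `b`.
        decidable-stable (Fin.any? λ k → (k ∈? avoiding) ×-dec concurrent? a b k)
          λ ¬abk → ¬b (b , q∈b , p∉b , ¬abk))
      ...     | yes (b , q∈b , p∉b , ¬abk) = inj₁
        ( ⁅ l ⁆ ∪ ⁅ a ⁆ ∪ ⁅ b ⁆ ∪ avoiding
        , twoPacking-l,a,b p∈l q∈l p∈a q∉a q∈b p∉b
            (λ i∈U j∈U i≢j x∈i x∈j → ¬meeting (_ , _ , _ , i∈U , j∈U , i≢j , x∈i , x∈j))
            (λ k∈U abk → ¬abk (_ , k∈U , abk))
        , 3+∣avoiding∣≤ p∈l q∈l p∈a q∉a q∈b p∉b )

theorem2p1 : ∀ {n m : ℕ} (L : LinearSystem n m) (τ ν₂ : ℕ) →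
    IsTransversalNumber L τ →
    IsTwoPackingNumber L ν₂ →
    ν₂ < m →
    (p q : Fin n) → p ≢ q →
    IsMaximumDegree L (deg L p) →
    IsMaximum (λ d → ∃[ x ] x ≢ p × deg L x ≡ d) (deg L q) →
    m + 3 ≤ deg L p + deg L q + ν₂ →
    τ + 1 ≤ ν₂
theorem2p1 {n} {m} L τ ν₂ isτ isν₂ _ p q p≢q _ _ bound =
  ≤-trans (≤-reflexive (+-comm τ 1)) τ<ν₂
  where
  open LinearSystem L

  Lp∩Lq : Subset m
  Lp∩Lq = linesThrough L p ∩ linesThrough L q

  U : Subset m
  U = avoiding L p q

  3+∣U∣≤∣Lp∩Lq∣+ν₂ : 3 + ∣ U ∣ ≤ ∣ Lp∩Lq ∣ + ν₂
  3+∣U∣≤∣Lp∩Lq∣+ν₂ = 3+∣avoiding∣≤∣Lp∩Lq∣+ν₂ L p q ν₂ bound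

  small-U : 3 + ∣ U ∣ ≤ ν₂ → τ < ν₂
  small-U = ≤-trans (s≤s (transversalNumber≤2+∣avoiding∣ L p q isτ))

  on-both : ∀ {i} → i ∈ Lp∩Lq → p ∈ line i × q ∈ line i
  on-both i∈ with x∈p∩q⁻ (linesThrough L p) (linesThrough L q) i∈
  ... | i∈Lp , i∈Lq = ∈linesThrough⁻ L i∈Lp , ∈linesThrough⁻ L i∈Lq

  τ<ν₂ : τ < ν₂
  τ<ν₂ with nonempty? Lp∩Lq
  -- Without a common line the intersection has size 0, and the count itself gives `3 + ∣ U ∣ ≤ ν₂`.
  ... | no empty = small-U (subst (λ c → 3 + ∣ U ∣ ≤ c + ν₂)
    (trans (cong ∣_∣ (Empty-unique empty)) (∣⊥∣≡0 m)) 3+∣U∣≤∣Lp∩Lq∣+ν₂)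
  ... | yes (l , l∈) with on-both l∈
  ...   | p∈l , q∈l with twoPacking⊎small L p q isτ p∈l q∈l
  ...     | inj₁ (R , packing , 3+∣U∣≤∣R∣) =
    small-U (≤-trans 3+∣U∣≤∣R∣ (proj₂ isν₂ _ (R , packing , refl)))
  -- Two common lines would share both `p` and `q`, so `l` is the only one and the count gives
  -- `3 + ∣ U ∣ ≤ 1 + ν₂`. Cancelling one unit leaves `suc τ ≤ 2 + ∣ U ∣ ≤ ν₂`.
  ...     | inj₂ τ≤1+∣U∣ = ≤-trans (s≤s τ≤1+∣U∣)
    (s≤s⁻¹ (≤-trans 3+∣U∣≤∣Lp∩Lq∣+ν₂ (+-monoˡ-≤ ν₂ (unique⇒∣p∣≤1 l-unique))))
    where
    l-unique : ∀ {i} → i ∈ Lp∩Lq → i ≡ l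
    l-unique {i} i∈ = decidable-stable (i Fin.≟ l) λ i≢l →
      let p∈i , q∈i = on-both i∈ in p≢q (meet-unique L i≢l p∈i p∈l q∈i q∈l)
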